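{- Let $G,H\in\mathcal E$ both be reduced in $\mathcal E$. If $G\equiv_{\mathcal E}H$, then $G\cong H$ (i.e. $G$ and $H$ have identical game trees).
   Context: All games are short two-player partizan games between Left and Right, identified with their game trees: $G=\{G^{\mathcal L}\mid G^{\mathcal R}\}$ with finite sets of options; $\mathbf 0=\{\;\mid\;\}$; $G\cong H$ means identical game trees. Followers of $G$: $G$, its options, their options, etc. Disjunctive sum: $G+H=\{G^{\mathcal L}+H,G+H^{\mathcal L}\mid G^{\mathcal R}+H,G+H^{\mathcal R}\}$; conjugate $\overline G=\{\overline{G^{\mathcal R}}\mid\overline{G^{\mathcal L}}\}$. Misère play: a player with no move on their turn wins. $o_L(G)=\mathrm L$ if $G^{\mathcal L}=\emptyset$, else $\max_{G^L}o_R(G^L)$; $o_R(G)=\mathrm R$ if $G^{\mathcal R}=\emptyset$, else $\min_{G^R}o_L(G^R)$; $\mathrm L>\mathrm R$; $o(G)=(o_L(G),o_R(G))$ ordered componentwise. A Left-end has no Left option; a dead Left-end has only Left-ends as followers; similarly Right. A game is dead-ending if each follower that is a Left-end (Right-end) is a dead Left-end (dead Right-end); $\mathcal E$ is the class of dead-ending games. $G\geq_{\mathcal E}H$ means $o(G+X)\geq o(H+X)$ for all $X\in\mathcal E$; $\equiv_{\mathcal E}$ means both directions. Perfect murders: $M_0=\mathbf 0$, $M_n=\{\;\mid\mathbf 0,M_{n-1}\}$. Strong outcomes: $\hat o_L(K)=\min\{o_L(K+X):X\in\mathcal E\text{ a Left-end}\}$, $\hat o_R(K)=\max\{o_R(K+Y):Y\in\mathcal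 E\text{ a Right-end}\}$. For a game $K$: a Left option $A$ of $K$ is end-reversible if $A$ has a Right option $B$ with no Left options and $B\leq_{\mathcal E}K$; it is open-reversible if it has a Right option $B$ with $B\leq_{\mathcal E}K$ and $B$ has a Left option. A Right option $C$ of $K$ is end-reversible if $C$ has a Left option $D$ with no Right options and $D\geq_{\mathcal E}K$; open-reversible if it has a Left option $D\geq_{\mathcal E}K$ having a Right option. A Left option $A$ of $K$ is fundamental if $\hat o_L(K)=\mathrm L$ and $\hat o_L(\{K^{\mathcal L}\setminus\{A\}\mid K^{\mathcal R}\})=\mathrm R$; a Right option $C$ is fundamental if $\hat o_R(K)=\mathrm R$ and $\hat o_R(\{K^{\mathcal L}\mid K^{\mathcal R}\setminus\{C\}\})=\mathrm L$. A game $K\in\mathcal E$ is locally reduced if none of the following holds: (R1) there are distinct $A,B\in K^{\mathcal L}$ with $A\leq_{\mathcal E}B$, or distinct $A,B\in K^{\mathcal R}$ with $A\geq_{\mathcal E}B$; (R2) $K$ has an open-reversible Left or Right option; (R3) $K$ has an end-reversible Left option $A$ that is not fundamental with $\{K^{\mathcal L}\setminus\{A\}\mid K^{\mathcal R}\}\in\mathcal E$, or an end-reversible Right option $C$ that is not fundamental with $\{K^{\mathcal L}\mid K^{\mathcal R}\setminus\{C\}\}\in\mathcal E$; (R4) $K=\{A\mid C\}$ with single Left option $A$ and single Right option $C$, both end-reversible; (R5) $K$ has an end-reversible Left option not identical to $\{\;\mid M_n\}$ where $n$ is the least nonnegative integer with $K\geq_{\mathcal E}M_n$, or an end-reversible Right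 option not identical to $\{\overline{M_n}\mid\;\}$ where $n$ is the least nonnegative integer with $K\leq_{\mathcal E}\overline{M_n}$. A game $G\in\mathcal E$ is reduced in $\mathcal E$ if every follower of $G$ (including $G$) is locally reduced. -}

module Defs where

open import Data.Nat using (ℕ; zero; suc; _<_)
open import Data.Bool using (Bool; true; false; _∧_; _∨_; not; T)
open import Data.List using (List; []; _∷_; _++_; filterᵇ)
open import Data.List.Membership.Propositional using (_∈_)
open import Data.List.Relation.Unary.All using (All)
open import Data.Product using (Σ; Σ-syntax; _×_)
open import Data.Sum using (_⊎_)
open import Data.Unit using (⊤)
open import Data.Empty using (⊥)
open import Relation.Nullary using (¬_)
open import Relation.Binary.PropositionalEquality using (_≡_; _≢_)

-- Short games as finite trees.  The Left/Right option *sets* are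
-- represented by lists; identity of game trees (≅) is therefore taken
-- up to order and repetition of options (set semantics), see _≅_.

data Game : Set where
  ⟨_∣_⟩ : List Game → List Game → Game

left : Game → List Game
left ⟨ l ∣ _ ⟩ = l

right : Game → List Game
right ⟨ _ ∣ r ⟩ = r

𝟘 : Game
𝟘 = ⟨ [] ∣ [] ⟩

mutual
  _≅ᵇ_ : Game → Game → Bool
  ⟨ gl ∣ gr ⟩ ≅ᵇ ⟨ hl ∣ hr ⟩ =
    (⊆ᵇ gl hl ∧ ⊆ᵇ hl gl) ∧ (⊆ᵇ gr hr ∧ ⊆ᵇ hr gr)

  ⊆ᵇ : List Game → List Game → Bool
  ⊆ᵇ [] ys = true
  ⊆ᵇ (x ∷ xs) ys = ∈ᵇ x ys ∧ ⊆ᵇ xs ys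

  ∈ᵇ : Game → List Game → Bool
  ∈ᵇ x [] = false
  ∈ᵇ x (y ∷ ys) = (x ≅ᵇ y) ∨ ∈ᵇ x ys

_≅_ : Game → Game → Set
G ≅ H = T (G ≅ᵇ H)

mutual
  _+_ : Game → Game → Game
  G@(⟨ gl ∣ gr ⟩) + H@(⟨ hl ∣ hr ⟩) =
    ⟨ (gl +ₗ H) ++ (G ₗ+ hl) ∣ (gr +ₗ H) ++ (G ₗ+ hr) ⟩

  _+ₗ_ : List Game → Game → List Game
  [] +ₗ H = []
  (x ∷ xs) +ₗ H = (x + H) ∷ (xs +ₗ H)

  _ₗ+_ : Game → List Game → List Game
  G ₗ+ [] = []
  G ₗ+ (y ∷ ys) = (G + y) ∷ (G ₗ+ ys)

infixl 6 _+_

mutual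
  conj : Game → Game
  conj ⟨ l ∣ r ⟩ = ⟨ conjs r ∣ conjs l ⟩

  conjs : List Game → List Game
  conjs [] = []
  conjs (x ∷ xs) = conj x ∷ conjs xs

data Res : Set where
  L R : Res

_≥ʳ_ : Res → Res → Set
L ≥ʳ _ = ⊤
R ≥ʳ R = ⊤
R ≥ʳ L = ⊥

_⊔ʳ_ : Res → Res → Res
L ⊔ʳ _ = L
R ⊔ʳ y = y

_⊓ʳ_ : Res → Res → Res
R ⊓ʳ _ = R
L ⊓ʳ y = y

mutual
  oL : Game → Res
  oL ⟨ [] ∣ _ ⟩ = L
  oL ⟨ x ∷ xs ∣ _ ⟩ = maxOR (x ∷ xs)

  oR : Game → Res
  oR ⟨ _ ∣ [] ⟩ = R
  oR ⟨ _ ∣ x ∷ xs ⟩ = minOL (x ∷ xs)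

  maxOR : List Game → Res
  maxOR [] = R
  maxOR (x ∷ xs) = oR x ⊔ʳ maxOR xs

  minOL : List Game → Res
  minOL [] = L
  minOL (x ∷ xs) = oL x ⊓ʳ minOL xs

_≥ᵒ_ : Game → Game → Set
G ≥ᵒ H = (oL G ≥ʳ oL H) × (oR G ≥ʳ oR H)

data _≼_ : Game → Game → Set where
  here  : ∀ {G} → G ≼ G
  viaL  : ∀ {F H G} → H ∈ left G → F ≼ H → F ≼ G
  viaR  : ∀ {F H G} → H ∈ right G → F ≼ H → F ≼ G

LeftEnd : Game → Set
LeftEnd G = left G ≡ []

RightEnd : Game → Set
RightEnd G = right G ≡ []

DeadLeftEnd : Game → Set
DeadLeftEnd G = ∀ F → F ≼ G → LeftEnd F

DeadRightEnd : Game → Set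
DeadRightEnd G = ∀ F → F ≼ G → RightEnd F

DeadEnding : Game → Set
DeadEnding G = ∀ F → F ≼ G →
  (LeftEnd F → DeadLeftEnd F) × (RightEnd F → DeadRightEnd F)

_≥E_ : Game → Game → Set
G ≥E H = ∀ X → DeadEnding X → (G + X) ≥ᵒ (H + X)

_≤E_ : Game → Game → Set
G ≤E H = H ≥E G

_≡E_ : Game → Game → Set
G ≡E H = (G ≥E H) × (H ≥E G)

M : ℕ → Game
M zero = 𝟘
M (suc n) = ⟨ [] ∣ 𝟘 ∷ M n ∷ [] ⟩

-- Strong outcomes (as the two possible values of a min / max over 𝓔;
-- note 0 is both a Left-end and a Right-end in 𝓔, so the sets are nonempty)

HatOL-isL : Game → Set
HatOL-isL K = ∀ X → DeadEnding X → LeftEnd X → oL (K + X) ≡ L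

HatOL-isR : Game → Set
HatOL-isR K = Σ[ X ∈ Game ] DeadEnding X × LeftEnd X × oL (K + X) ≡ R

HatOR-isR : Game → Set
HatOR-isR K = ∀ Y → DeadEnding Y → RightEnd Y → oR (K + Y) ≡ R

HatOR-isL : Game → Set
HatOR-isL K = Σ[ Y ∈ Game ] DeadEnding Y × RightEnd Y × oR (K + Y) ≡ L

-- Removing an option (as an element of the option *set*)

removeL : Game → Game → Game
removeL K A = ⟨ filterᵇ (λ B → not (B ≅ᵇ A)) (left K) ∣ right K ⟩

removeR : Game → Game → Game
removeR K C = ⟨ left K ∣ filterᵇ (λ D → not (D ≅ᵇ C)) (right K) ⟩

-- Reversibility and fundamental options (A ∈ left K, C ∈ right K)

EndRevL : Game → Game → Set
EndRevL K A = Σ[ B ∈ Game ] B ∈ right A × LeftEnd B × B ≤E K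

OpenRevL : Game → Game → Set
OpenRevL K A = Σ[ B ∈ Game ] B ∈ right A × B ≤E K × left B ≢ []

EndRevR : Game → Game → Set
EndRevR K C = Σ[ D ∈ Game ] D ∈ left C × RightEnd D × D ≥E K

OpenRevR : Game → Game → Set
OpenRevR K C = Σ[ D ∈ Game ] D ∈ left C × D ≥E K × right D ≢ []

FundL : Game → Game → Set
FundL K A = HatOL-isL K × HatOL-isR (removeL K A)

FundR : Game → Game → Set
FundR K C = HatOR-isR K × HatOR-isL (removeR K C)

R1 : Game → Set
R1 K = (Σ[ A ∈ Game ] Σ[ B ∈ Game ] A ∈ left K × B ∈ left K × ¬ (A ≅ B) × A ≤E B)
     ⊎ (Σ[ A ∈ Game ] Σ[ B ∈ Game ] A ∈ right K × B ∈ right K × ¬ (A ≅ B) × A ≥E B)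

R2 : Game → Set
R2 K = (Σ[ A ∈ Game ] A ∈ left K × OpenRevL K A)
     ⊎ (Σ[ C ∈ Game ] C ∈ right K × OpenRevR K C)

R3 : Game → Set
R3 K = (Σ[ A ∈ Game ] A ∈ left K × EndRevL K A × ¬ FundL K A × DeadEnding (removeL K A))
     ⊎ (Σ[ C ∈ Game ] C ∈ right K × EndRevR K C × ¬ FundR K C × DeadEnding (removeR K C))

-- K = {A | C}: the Left option set is {A}, the Right option set is {C}
R4 : Game → Set
R4 K = Σ[ A ∈ Game ] Σ[ C ∈ Game ]
         A ∈ left K × All (λ A' → A' ≅ A) (left K) ×
         C ∈ right K × All (λ C' → C' ≅ C) (right K) ×
         EndRevL K A × EndRevR K C

R5 : Game → Set
R5 K = (Σ[ A ∈ Game ] A ∈ left K × EndRevL K A ×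
          Σ[ n ∈ ℕ ] (K ≥E M n) × (∀ m → m < n → ¬ (K ≥E M m)) ×
            ¬ (A ≅ ⟨ [] ∣ M n ∷ [] ⟩))
     ⊎ (Σ[ C ∈ Game ] C ∈ right K × EndRevR K C ×
          Σ[ n ∈ ℕ ] (K ≤E conj (M n)) × (∀ m → m < n → ¬ (K ≤E conj (M m))) ×
            ¬ (C ≅ ⟨ conj (M n) ∷ [] ∣ [] ⟩))

LocallyReduced : Game → Set
LocallyReduced K = DeadEnding K × ¬ (R1 K ⊎ R2 K ⊎ R3 K ⊎ R4 K ⊎ R5 K)

Reduced : Game → Set
Reduced G = DeadEnding G × (∀ F → F ≼ G → LocallyReduced F)

{-# OPTIONS --safe #-}
module Submission where

-- The key tool is the maintenance property: if G ≥ H, every Left option of H either lies below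
-- a Left option of G or has a Right option below G.  Otherwise the games witnessing all these
-- failures can be assembled into one dead-ending game distinguishing G from H the wrong way.
-- For equivalent reduced G and H it matches, inductively, the options of G and H that are not
-- reversible.  A reversible Left option reverses through a dead Left-end, which lies above some
-- perfect murder, so it is {∣ M n} for an n depending only on the equivalence class.  If only G
-- has such an option, then G without it has the same Left options as H; it is thus not
-- fundamental, and the remaining reduction rules exclude this.
--
-- Identity of game trees is decidable, so the classical steps take place under double negation.

open import Defs

open import Data.Bool using (Bool; true; false; not; T; _∧_)
open import Data.Bool.Properties using (T-∧; T-∨; T-not-≡; T?)
open import Data.Empty using (⊥; ⊥-elim)
open import Data.List using (List; []; _∷_; _++_; map; filterᵇ)
open import Data.List.Membership.Propositional using (_∈_)
open import Data.List.Membership.Propositional.Properties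
  using (∈-map⁺; ∈-map⁻; ∈-++⁺ˡ; ∈-++⁺ʳ; ∈-++⁻; ∈-filter⁺; ∈-filter⁻)
open import Data.List.Relation.Unary.All as All using (All; []; _∷_)
open import Data.List.Relation.Unary.Any using (here; there)
open import Data.Nat using (ℕ; zero; suc; _<_; _≤_; s≤s; _⊔_)
open import Data.Nat.Induction using (<-rec)
open import Data.Nat.Properties using (≤-trans; m≤m⊔n; m≤n⊔m; ≤-refl)
open import Data.Product using (Σ-syntax; ∃-syntax; _×_; _,_; proj₁; proj₂; swap; map₁; map₂)
open import Data.Sum using (_⊎_; inj₁; inj₂)
open import Data.Unit using (tt)
open import Effect.Monad using (RawMonad)
open import Function using (_∘_; id; Equivalence)
open import Level using (0ℓ)
open import Relation.Binary.PropositionalEquality using (_≡_; _≢_; refl; sym; trans; cong; cong₂; subst)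
open import Relation.Nullary using (¬_; Dec; yes; no; contradiction)
open import Relation.Nullary.Decidable using (decidable-stable; ¬¬-excluded-middle)
open import Relation.Nullary.Negation using (¬¬-Monad; ¬¬-map)

open RawMonad {f = 0ℓ} ¬¬-Monad using (_>>=_; pure)
open Equivalence using (to; from)

private
  variable
    A B C F G H K X Y Z : Game
    s : Res

-- Players

opp : Res → Res
opp L = R
opp R = L

opp-opp : ∀ s → opp (opp s) ≡ s
opp-opp L = refl
opp-opp R = refl

opts : Res → Game → List Game
opts L = left
opts R = right

outcome : Res → Game → Res
outcome L = oL
outcome R = oR

-- The options of player `s` come first, so that one argument serves both players.
game : Res → List Game → List Game → Game
game L as bs = ⟨ as ∣ bs ⟩
game R as bs = ⟨ bs ∣ as ⟩

opts-game : ∀ s {as bs} → opts s (game s as bs) ≡ as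
opts-game L = refl
opts-game R = refl

∈-game : ∀ s {as bs} → A ∈ as → A ∈ opts s (game s as bs)
∈-game L A∈ = A∈
∈-game R A∈ = A∈

∈-game-opp : ∀ s {as bs} → B ∈ bs → B ∈ opts (opp s) (game s as bs)
∈-game-opp L B∈ = B∈
∈-game-opp R B∈ = B∈

game-∈ : ∀ s {as bs} → A ∈ opts s (game s as bs) → A ∈ as
game-∈ L A∈ = A∈
game-∈ R A∈ = A∈

game-opp-∈ : ∀ s {as bs} → B ∈ opts (opp s) (game s as bs) → B ∈ bs
game-opp-∈ L B∈ = B∈
game-opp-∈ R B∈ = B∈

∈⇒≢[] : ∀ {xs : List Game} → A ∈ xs → xs ≢ []
∈⇒≢[] () refl

empty? : (xs : List Game) → xs ≡ [] ⊎ ∃[ x ] x ∈ xs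
empty? []       = inj₁ refl
empty? (x ∷ xs) = inj₂ (x , here refl)

≡[]-stable : (xs : List Game) → ¬ ¬ (xs ≡ []) → xs ≡ []
≡[]-stable []       _ = refl
≡[]-stable (_ ∷ _) ¬¬e = ⊥-elim (¬¬e λ ())

module _ (P : Game → Set) (step : ∀ G → (∀ s {A} → A ∈ opts s G → P A) → P G) where

  mutual
    game-induction : ∀ G → P G
    game-induction ⟨ as ∣ bs ⟩ =
      step ⟨ as ∣ bs ⟩ λ { L → All.lookup (options-induction as) ; R → All.lookup (options-induction bs) }

    options-induction : ∀ as → All P as
    options-induction []       = []
    options-induction (A ∷ as) = game-induction A ∷ options-induction as

-- Moves in a sum

+ₗ≡map : ∀ as H → as +ₗ H ≡ map (_+ H) as
+ₗ≡map []       H = refl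
+ₗ≡map (A ∷ as) H = cong (A + H ∷_) (+ₗ≡map as H)

ₗ+≡map : ∀ G bs → G ₗ+ bs ≡ map (G +_) bs
ₗ+≡map G []       = refl
ₗ+≡map G (B ∷ bs) = cong (G + B ∷_) (ₗ+≡map G bs)

opts-+ : ∀ s G H → opts s (G + H) ≡ map (_+ H) (opts s G) ++ map (G +_) (opts s H)
opts-+ L G@(⟨ _ ∣ _ ⟩) H@(⟨ _ ∣ _ ⟩) = cong₂ _++_ (+ₗ≡map (left G) H) (ₗ+≡map G (left H))
opts-+ R G@(⟨ _ ∣ _ ⟩) H@(⟨ _ ∣ _ ⟩) = cong₂ _++_ (+ₗ≡map (right G) H) (ₗ+≡map G (right H))

∈-+ˡ : ∀ s → A ∈ opts s G → A + X ∈ opts s (G + X)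
∈-+ˡ {G = G} {X = X} s A∈ = subst (_ ∈_) (sym (opts-+ s G X)) (∈-++⁺ˡ (∈-map⁺ (_+ X) A∈))

∈-+ʳ : ∀ s → Y ∈ opts s X → G + Y ∈ opts s (G + X)
∈-+ʳ {X = X} {G = G} s Y∈ =
  subst (_ ∈_) (sym (opts-+ s G X)) (∈-++⁺ʳ (map (_+ X) (opts s G)) (∈-map⁺ (G +_) Y∈))

∈-+⁻ : ∀ s G X → Z ∈ opts s (G + X) →
  (∃[ A ] A ∈ opts s G × Z ≡ A + X) ⊎ (∃[ Y ] Y ∈ opts s X × Z ≡ G + Y)
∈-+⁻ s G X Z∈ with ∈-++⁻ (map (_+ X) (opts s G)) (subst (_ ∈_) (opts-+ s G X) Z∈)
... | inj₁ Z∈ˡ = inj₁ (∈-map⁻ (_+ X) Z∈ˡ)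
... | inj₂ Z∈ʳ = inj₂ (∈-map⁻ (G +_) Z∈ʳ)

end-+ : ∀ s G X → opts s G ≡ [] → opts s X ≡ [] → opts s (G + X) ≡ []
end-+ s G X G-end X-end rewrite opts-+ s G X | G-end | X-end = refl

end-+⁻ : ∀ s G X → opts s (G + X) ≡ [] → opts s G ≡ [] × opts s X ≡ []
end-+⁻ s G X e with opts s G | opts s X | opts-+ s G X
... | []    | []    | _ = refl , refl
... | []    | _ ∷ _ | q = contradiction (trans (sym q) e) λ ()
... | _ ∷ _ | _     | q = contradiction (trans (sym q) e) λ ()

-- Winning when moving first

Win : Res → Game → Set
Win s G = outcome s G ≡ s

_≟ʳ_ : (a b : Res) → Dec (a ≡ b)
L ≟ʳ L = yes refl
L ≟ʳ R = no λ ()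
R ≟ʳ L = no λ ()
R ≟ʳ R = yes refl

Win-stable : ∀ s G → ¬ ¬ Win s G → Win s G
Win-stable s G = decidable-stable (outcome s G ≟ʳ s)

maxOR-∈ : ∀ {as} → A ∈ as → oR A ≢ R → maxOR as ≡ L
maxOR-∈ {A} (here refl) l with oR A
... | L = refl
... | R = contradiction refl l
maxOR-∈ {as = B ∷ _} (there A∈) l with oR B
... | L = refl
... | R = maxOR-∈ A∈ l

minOL-∈ : ∀ {as} → A ∈ as → oL A ≢ L → minOL as ≡ R
minOL-∈ {A} (here refl) l with oL A
... | R = refl
... | L = contradiction refl l
minOL-∈ {as = B ∷ _} (there A∈) l with oL B
... | R = refl
... | L = minOL-∈ A∈ l

maxOR⁻ : ∀ as → maxOR as ≡ L → ∃[ A ] A ∈ as × oR A ≢ R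
maxOR⁻ (A ∷ as) w with oR A in eq
... | L = A , here refl , λ q → contradiction (trans (sym eq) q) λ ()
... | R with maxOR⁻ as w
... | B , B∈ , l = B , there B∈ , l

minOL⁻ : ∀ as → minOL as ≡ R → ∃[ A ] A ∈ as × oL A ≢ L
minOL⁻ (A ∷ as) w with oL A in eq
... | R = A , here refl , λ q → contradiction (trans (sym eq) q) λ ()
... | L with minOL⁻ as w
... | B , B∈ , l = B , there B∈ , l

Win-end : ∀ s G → opts s G ≡ [] → Win s G
Win-end L ⟨ [] ∣ _ ⟩ refl = refl
Win-end R ⟨ _ ∣ [] ⟩ refl = refl

Win-move : ∀ s → A ∈ opts s G → ¬ Win (opp s) A → Win s G
Win-move {G = ⟨ _ ∷ _ ∣ _ ⟩} L A∈ l = maxOR-∈ A∈ l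
Win-move {G = ⟨ _ ∣ _ ∷ _ ⟩} R A∈ l = minOL-∈ A∈ l

Win⁻ : ∀ s G → Win s G → opts s G ≡ [] ⊎ ∃[ A ] A ∈ opts s G × ¬ Win (opp s) A
Win⁻ L ⟨ []     ∣ _ ⟩      w = inj₁ refl
Win⁻ L ⟨ A ∷ as ∣ _ ⟩      w = inj₂ (maxOR⁻ (A ∷ as) w)
Win⁻ R ⟨ _      ∣ [] ⟩     w = inj₁ refl
Win⁻ R ⟨ _      ∣ B ∷ bs ⟩ w = inj₂ (minOL⁻ (B ∷ bs) w)

Win-+ˡ : ∀ s → A ∈ opts s G → ¬ Win (opp s) (A + X) → Win s (G + X)
Win-+ˡ s A∈ = Win-move s (∈-+ˡ s A∈)

Win-+ʳ : ∀ s → Y ∈ opts s X → ¬ Win (opp s) (G + Y) → Win s (G + X)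
Win-+ʳ s Y∈ = Win-move s (∈-+ʳ s Y∈)

data Win+ (s : Res) (G X : Game) : Set where
  ends  : opts s G ≡ [] → opts s X ≡ [] → Win+ s G X
  moveˡ : A ∈ opts s G → ¬ Win (opp s) (A + X) → Win+ s G X
  moveʳ : Y ∈ opts s X → ¬ Win (opp s) (G + Y) → Win+ s G X

Win-+⁻ : ∀ s G X → Win s (G + X) → Win+ s G X
Win-+⁻ s G X w with Win⁻ s (G + X) w
... | inj₁ e = ends (proj₁ (end-+⁻ s G X e)) (proj₂ (end-+⁻ s G X e))
... | inj₂ (Z , Z∈ , l) with ∈-+⁻ s G X Z∈
... | inj₁ (_ , A∈ , refl) = moveˡ A∈ l
... | inj₂ (_ , Y∈ , refl) = moveʳ Y∈ l

-- An option of `X` has to be exhibited because under misère play a player without a move wins.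
¬Win-+ : ∀ s → Y ∈ opts s X → (∀ {A} → A ∈ opts s G → Win (opp s) (A + X)) →
  (∀ {Y} → Y ∈ opts s X → Win (opp s) (G + Y)) → ¬ Win s (G + X)
¬Win-+ {X = X} {G = G} s Y∈ wˡ wʳ w with Win-+⁻ s G X w
... | ends _ X-end = ∈⇒≢[] Y∈ X-end
... | moveˡ A∈ l   = l (wˡ A∈)
... | moveʳ Y∈′ l  = l (wʳ Y∈′)

-- Dead ends and dead-ending games

End : Res → Game → Set
End s G = opts s G ≡ []

Dead : Res → Game → Set
Dead s G = ∀ F → F ≼ G → End s F

via : ∀ s → A ∈ opts s G → F ≼ A → F ≼ G
via L = viaL
via R = viaR

≼-trans : F ≼ G → G ≼ H → F ≼ H
≼-trans F≼ here         = F≼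
≼-trans F≼ (viaL A∈ G≼) = viaL A∈ (≼-trans F≼ G≼)
≼-trans F≼ (viaR A∈ G≼) = viaR A∈ (≼-trans F≼ G≼)

≼-opt : ∀ s → A ∈ opts s G → A ≼ G
≼-opt s A∈ = via s A∈ here

≼⁻ : ∀ s → F ≼ G → F ≡ G ⊎ (∃[ A ] A ∈ opts s G × F ≼ A) ⊎ (∃[ A ] A ∈ opts (opp s) G × F ≼ A)
≼⁻ _ here         = inj₁ refl
≼⁻ L (viaL A∈ F≼) = inj₂ (inj₁ (_ , A∈ , F≼))
≼⁻ L (viaR A∈ F≼) = inj₂ (inj₂ (_ , A∈ , F≼))
≼⁻ R (viaL A∈ F≼) = inj₂ (inj₂ (_ , A∈ , F≼))
≼⁻ R (viaR A∈ F≼) = inj₂ (inj₁ (_ , A∈ , F≼))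

Dead-≼ : ∀ s → F ≼ G → Dead s G → Dead s F
Dead-≼ s F≼ d F′ F′≼ = d F′ (≼-trans F′≼ F≼)

DeadEnding-≼ : F ≼ G → DeadEnding G → DeadEnding F
DeadEnding-≼ F≼ d F′ F′≼ = d F′ (≼-trans F′≼ F≼)

DeadEnding⇒Dead : ∀ s → DeadEnding G → F ≼ G → End s F → Dead s F
DeadEnding⇒Dead L d F≼ = proj₁ (d _ F≼)
DeadEnding⇒Dead R d F≼ = proj₂ (d _ F≼)

DeadEnding-intro : (∀ s F → F ≼ G → End s F → Dead s F) → DeadEnding G
DeadEnding-intro f F F≼ = f L F F≼ , f R F F≼

Dead-game : ∀ s → End s G → (∀ {B} → B ∈ opts (opp s) G → Dead s B) → Dead s G
Dead-game s e d F F≼ with ≼⁻ s F≼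
... | inj₁ refl                   = e
... | inj₂ (inj₁ (_ , A∈ , _))    = contradiction e (∈⇒≢[] A∈)
... | inj₂ (inj₂ (_ , B∈ , F≼B))  = d B∈ F F≼B

DeadEnding-opts : ∀ s → (∀ {A} → A ∈ opts s G → DeadEnding A) →
  (∀ {A} → A ∈ opts (opp s) G → DeadEnding A) →
  (∀ r → End r G → Dead r G) → DeadEnding G
DeadEnding-opts s d d′ e = DeadEnding-intro λ r F F≼ F-end → helper r F F≼ F-end (≼⁻ s F≼)
  where
  helper : ∀ r F → F ≼ _ → End r F → _ → Dead r F
  helper r F F≼ F-end (inj₁ refl)                  = e r F-end
  helper r F F≼ F-end (inj₂ (inj₁ (_ , A∈ , F≼A))) = DeadEnding⇒Dead r (d A∈) F≼A F-end
  helper r F F≼ F-end (inj₂ (inj₂ (_ , A∈ , F≼A))) = DeadEnding⇒Dead r (d′ A∈) F≼A F-end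

-- With options on both sides the root is no end, so only the options need checking. The
-- distinguishing games below are built in this form.
DeadEnding-dicot : ∀ s {as bs} → All DeadEnding (A ∷ as) → All DeadEnding (B ∷ bs) →
  DeadEnding (game s (A ∷ as) (B ∷ bs))
DeadEnding-dicot s da db =
  DeadEnding-opts s (λ A∈ → All.lookup da (game-∈ s A∈)) (λ B∈ → All.lookup db (game-opp-∈ s B∈)) (no-end s)
  where
  no-end : ∀ s {as bs} r → End r (game s (_ ∷ as) (_ ∷ bs)) → Dead r (game s (_ ∷ as) (_ ∷ bs))
  no-end L L ()
  no-end L R ()
  no-end R L ()
  no-end R R ()

DeadEnding-𝟘 : DeadEnding 𝟘
DeadEnding-𝟘 .𝟘 here = (λ { _ .𝟘 here → refl }) , (λ { _ .𝟘 here → refl })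

-- The adjoint

orZero : List Game → List Game
orZero []       = 𝟘 ∷ []
orZero (A ∷ as) = A ∷ as

-- The option 𝟘 is supplied where options would be missing, so that adjoints are dicots
-- and hence dead-ending, whatever G is.
mutual
  adjoint : Game → Game
  adjoint ⟨ as ∣ bs ⟩ = ⟨ orZero (adjoints bs) ∣ orZero (adjoints as) ⟩

  adjoints : List Game → List Game
  adjoints []       = []
  adjoints (A ∷ as) = adjoint A ∷ adjoints as

opts-adjoint : ∀ s G → opts s (adjoint G) ≡ orZero (adjoints (opts (opp s) G))
opts-adjoint L ⟨ _ ∣ _ ⟩ = refl
opts-adjoint R ⟨ _ ∣ _ ⟩ = refl

∈-adjoints : ∀ {as} → A ∈ as → adjoint A ∈ adjoints as
∈-adjoints (here refl) = here refl
∈-adjoints (there A∈)  = there (∈-adjoints A∈)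

∈-orZero : ∀ {as} → A ∈ as → A ∈ orZero as
∈-orZero {as = _ ∷ _} A∈ = A∈

adjoints-∈ : ∀ {as} → Z ∈ adjoints as → ∃[ A ] A ∈ as × Z ≡ adjoint A
adjoints-∈ {as = A ∷ _} (here refl) = A , here refl , refl
adjoints-∈ {as = _ ∷ _} (there Z∈) with adjoints-∈ Z∈
... | A , A∈ , eq = A , there A∈ , eq

orZero-∈ : ∀ {as} → Z ∈ orZero (adjoints as) → (as ≡ [] × Z ≡ 𝟘) ⊎ (∃[ A ] A ∈ as × Z ≡ adjoint A)
orZero-∈ {as = []}    (here refl) = inj₁ (refl , refl)
orZero-∈ {as = _ ∷ _} Z∈          = inj₂ (adjoints-∈ Z∈)

∈-orZero-nonempty : ∀ as → ∃[ A ] A ∈ orZero as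
∈-orZero-nonempty []      = _ , here refl
∈-orZero-nonempty (_ ∷ _) = _ , here refl

adjoint-option : ∀ s G → ∃[ Y ] Y ∈ opts s (adjoint G)
adjoint-option s G rewrite opts-adjoint s G = ∈-orZero-nonempty _

∈-adjoint : ∀ s → A ∈ opts s G → adjoint A ∈ opts (opp s) (adjoint G)
∈-adjoint {G = G} s A∈ rewrite opts-adjoint (opp s) G | opp-opp s = ∈-orZero (∈-adjoints A∈)

adjoint-∈ : ∀ s G → Z ∈ opts s (adjoint G) →
  (End (opp s) G × Z ≡ 𝟘) ⊎ (∃[ A ] A ∈ opts (opp s) G × Z ≡ adjoint A)
adjoint-∈ s G Z∈ rewrite opts-adjoint s G = orZero-∈ Z∈

-- The second player answers each move in one component by the corresponding move in the other.
¬Win-adjoint : ∀ G s → ¬ Win s (G + adjoint G)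
¬Win-adjoint = game-induction _ λ G ih s →
  ¬Win-+ s (proj₂ (adjoint-option s G))
    (λ A∈ → Win-+ʳ (opp s) (∈-adjoint s A∈) (ih s A∈ (opp (opp s))))
    (λ Y∈ → answer G ih s (adjoint-∈ s G Y∈))
  where
  answer : ∀ G → (∀ s {A} → A ∈ opts s G → ∀ r → ¬ Win r (A + adjoint A)) → ∀ s →
    (End (opp s) G × Z ≡ 𝟘) ⊎ (∃[ A ] A ∈ opts (opp s) G × Z ≡ adjoint A) → Win (opp s) (G + Z)
  -- Neither component offers `opp s` a move, which is a win under misère play.
  answer G ih s (inj₁ (G-end , refl)) = Win-end (opp s) (G + 𝟘) (end-+ (opp s) G 𝟘 G-end (𝟘-end (opp s)))
    where
    𝟘-end : ∀ r → End r 𝟘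
    𝟘-end L = refl
    𝟘-end R = refl
  answer G ih s (inj₂ (A , A∈ , refl)) = Win-+ˡ (opp s) A∈ (ih (opp s) A∈ (opp (opp s)))

DeadEnding-adjoint : ∀ G → DeadEnding (adjoint G)
DeadEnding-adjoint = game-induction _ λ G ih →
  DeadEnding-opts L (λ Z∈ → option G ih R (adjoint-∈ L G Z∈)) (λ Z∈ → option G ih L (adjoint-∈ R G Z∈))
    (λ r e → contradiction e (∈⇒≢[] (proj₂ (adjoint-option r G))))
  where
  option : ∀ G → (∀ s {A} → A ∈ opts s G → DeadEnding (adjoint A)) → ∀ s →
    (End s G × Z ≡ 𝟘) ⊎ (∃[ A ] A ∈ opts s G × Z ≡ adjoint A) → DeadEnding Z
  option G ih s (inj₁ (_ , refl))     = DeadEnding-𝟘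
  option G ih s (inj₂ (_ , A∈ , refl)) = ih s A∈

-- Comparison from the point of view of one player: G ≥[ L ] H is G ≥E H, and G ≥[ R ] H is H ≥E G.

record _≥[_]_ (G : Game) (s : Res) (H : Game) : Set where
  constructor geq
  field
    compare : ∀ X → DeadEnding X →
      (Win s (H + X) → Win s (G + X)) × (Win (opp s) (G + X) → Win (opp s) (H + X))

open _≥[_]_

≥ʳ⇒L : ∀ {a b} → a ≥ʳ b → b ≡ L → a ≡ L
≥ʳ⇒L {L} _ _ = refl
≥ʳ⇒L {R} {L} () _
≥ʳ⇒L {R} {R} _ ()

≥ʳ⇒R : ∀ {a b} → a ≥ʳ b → a ≡ R → b ≡ R
≥ʳ⇒R {R} {R} _ _ = refl

L⇒≥ʳ : ∀ {a b} → (b ≡ L → a ≡ L) → a ≥ʳ b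
L⇒≥ʳ {L}     _ = tt
L⇒≥ʳ {R} {R} _ = tt
L⇒≥ʳ {R} {L} f = contradiction (f refl) λ ()

R⇒≥ʳ : ∀ {a b} → (a ≡ R → b ≡ R) → a ≥ʳ b
R⇒≥ʳ {L}     _ = tt
R⇒≥ʳ {R} {R} _ = tt
R⇒≥ʳ {R} {L} f = contradiction (f refl) λ ()

≥E⇒≥L : G ≥E H → G ≥[ L ] H
≥E⇒≥L ge = geq λ X d → ≥ʳ⇒L (proj₁ (ge X d)) , ≥ʳ⇒R (proj₂ (ge X d))

≥L⇒≥E : G ≥[ L ] H → G ≥E H
≥L⇒≥E ge X d = L⇒≥ʳ (proj₁ (compare ge X d)) , R⇒≥ʳ (proj₂ (compare ge X d))

≥-flip : ∀ s → G ≥[ s ] H → H ≥[ opp s ] G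
≥-flip L ge = geq λ X d → swap (compare ge X d)
≥-flip R ge = geq λ X d → swap (compare ge X d)

≥-unflip : ∀ s → H ≥[ opp s ] G → G ≥[ s ] H
≥-unflip L ge = ≥-flip R ge
≥-unflip R ge = ≥-flip L ge

≥-refl : ∀ s → G ≥[ s ] G
≥-refl s = geq λ X d → id , id

≥-trans : ∀ s → F ≥[ s ] G → G ≥[ s ] H → F ≥[ s ] H
≥-trans s p q = geq λ X d →
  proj₁ (compare p X d) ∘ proj₁ (compare q X d) , proj₂ (compare q X d) ∘ proj₂ (compare p X d)

-- Separating games

-- Only the outcome with `s` moving first is recorded; `Separated-flip` trades it for the other one.
Separated : Res → Game → Game → Set
Separated s G H = Σ[ X ∈ Game ] DeadEnding X × Win s (H + X) × ¬ Win s (G + X)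

-- One move is put in front of `X`. Player `opp s` wins `G + U` by moving to `G + X`. In `H + U`
-- that move loses, and a move to an option `B` of `H` is answered by the adjoint of `B`.
Separated-flip : ∀ s → Separated s G H → Separated (opp s) H G
Separated-flip {G} {H} s (X , dX , H-wins , G-loses) =
  U , DeadEnding-dicot s (DeadEnding-𝟘 ∷ replies-dead) (dX ∷ []) ,
  Win-+ʳ (opp s) (∈-game-opp s (here refl)) (subst (λ r → ¬ Win r (G + X)) (sym (opp-opp s)) G-loses) ,
  ¬Win-+ (opp s) (∈-game-opp s (here refl))
    (λ {B} B∈ → subst (λ r → Win r (B + U)) (sym (opp-opp s))
       (Win-+ʳ s (∈-game s (there (∈-adjoints B∈))) (¬Win-adjoint B (opp s))))
    (λ {Z} Y∈ → subst (λ r → Win r (H + Z)) (sym (opp-opp s)) (answer (game-opp-∈ s Y∈)))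
  where
  -- The option `𝟘` keeps `U` a dicot when `H` has no `opp s`-option.
  U : Game
  U = game s (𝟘 ∷ adjoints (opts (opp s) H)) (X ∷ [])
  replies-dead : All DeadEnding (adjoints (opts (opp s) H))
  replies-dead = All.tabulate λ Z∈ → let (A , _ , eq) = adjoints-∈ Z∈ in subst DeadEnding (sym eq) (DeadEnding-adjoint A)
  answer : Z ∈ X ∷ [] → Win s (H + Z)
  answer (here refl) = H-wins

Separated-unflip : ∀ s → Separated (opp s) H G → Separated s G H
Separated-unflip {H} {G} L = Separated-flip {H} {G} R
Separated-unflip {H} {G} R = Separated-flip {H} {G} L

-- The comparison can fail with either player moving first; `Separated-unflip` brings the second
-- failure into the form of the first.
≱⇒Separated : ∀ s → ¬ (G ≥[ s ] H) → ¬ ¬ Separated s G H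
≱⇒Separated {G} {H} s ≱ ¬sep = ≱ (geq λ X d →
  (λ w → Win-stable s (G + X) λ l → ¬sep (X , d , w , l)) ,
  (λ w → Win-stable (opp s) (H + X) λ l → ¬sep (Separated-unflip {H} {G} s (X , d , w , l))))

-- The maintenance property

-- Double negation passes through finitely many choices, so the separating games can be gathered
-- into one list.
collect : {P : Game → Set} {Q : Game → Game → Set} (xs : List Game) →
  (∀ {x} → x ∈ xs → ¬ ¬ (∃[ y ] P y × Q x y)) →
  ¬ ¬ (∃[ ys ] All P ys × (∀ {x} → x ∈ xs → ∃[ y ] y ∈ ys × Q x y))
collect []       f = pure ([] , [] , λ ())
collect (x ∷ xs) f = do
  (y , py , q)  ← f (here refl)
  (ys , ps , g) ← collect xs (f ∘ there)
  pure (y ∷ ys , py ∷ ps , λ { (here refl) → y , here refl , q ; (there x∈) → map₂ (map₁ there) (g x∈) })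

-- If no reply is available, the games separating A from the s-options of G become the (opp s)-options
-- of a game U, and those separating G from the (opp s)-options of A its s-options.  Player s then
-- wins H + U by moving to A + U, but loses G + U.
maintenance : ∀ s → G ≥[ s ] H → A ∈ opts s H →
  ¬ ¬ ((∃[ A′ ] A′ ∈ opts s G × A′ ≥[ s ] A) ⊎ (∃[ B ] B ∈ opts (opp s) A × G ≥[ s ] B))
maintenance {G} {H} {A} s ge A∈ none = collect (opts s G) sepˡ λ (xs , pxs , findˡ) →
  collect (opts (opp s) A) sepʳ λ (ys , pys , findʳ) → refute xs pxs findˡ ys pys findʳ
  where
  P Q : Game → Set
  P X = DeadEnding X × Win s (A + X)
  Q Y = DeadEnding Y × Win (opp s) (G + Y)
  sepˡ : ∀ {A′} → A′ ∈ opts s G → ¬ ¬ (∃[ X ] P X × ¬ Win s (A′ + X))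
  sepˡ A′∈ = ¬¬-map (λ (X , d , w , l) → X , (d , w) , l)
    (≱⇒Separated s λ ge′ → none (inj₁ (_ , A′∈ , ge′)))
  sepʳ : ∀ {B} → B ∈ opts (opp s) A → ¬ ¬ (∃[ Y ] Q Y × ¬ Win (opp s) (B + Y))
  -- Flipped, since `Y` is reached when `opp s` is to move.
  sepʳ B∈ = ¬¬-map (λ sep → let (Y , d , w , l) = Separated-flip s sep in Y , (d , w) , l)
    (≱⇒Separated s λ ge′ → none (inj₂ (_ , B∈ , ge′)))
  -- A harmless option for either side of `U`: in `K + reply r K` player `r`, to move, wins by going
  -- to `adjoint K`. It keeps `U` a dicot when there is nothing to separate.
  reply : Res → Game → Game
  reply r K = game r (adjoint K ∷ []) (𝟘 ∷ [])
  reply-dead : ∀ r K → DeadEnding (reply r K)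
  reply-dead r K = DeadEnding-dicot r (DeadEnding-adjoint K ∷ []) (DeadEnding-𝟘 ∷ [])
  reply-wins : ∀ r K → Win r (K + reply r K)
  reply-wins r K = Win-+ʳ r (∈-game r (here refl)) (¬Win-adjoint K (opp r))
  back : ∀ X → Win s X → Win (opp (opp s)) X
  back X = subst (λ r → Win r X) (sym (opp-opp s))
  refute : ∀ xs → All P xs → (∀ {A′} → A′ ∈ opts s G → ∃[ X ] X ∈ xs × ¬ Win s (A′ + X)) →
           ∀ ys → All Q ys → (∀ {B} → B ∈ opts (opp s) A → ∃[ Y ] Y ∈ ys × ¬ Win (opp s) (B + Y)) → ⊥
  refute xs pxs findˡ ys pys findʳ = G+U-loses (proj₁ (compare ge U U-dead) H+U-wins)
    where
    as bs : List Game
    as = reply (opp s) G ∷ ys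
    bs = reply s A ∷ xs
    U : Game
    U = game s as bs
    good-bs : All P bs
    good-bs = (reply-dead s A , reply-wins s A) ∷ pxs
    good-as : All Q as
    good-as = (reply-dead (opp s) G , reply-wins (opp s) G) ∷ pys
    U-dead : DeadEnding U
    U-dead = DeadEnding-dicot s (All.map proj₁ good-as) (All.map proj₁ good-bs)
    H+U-wins : Win s (H + U)
    H+U-wins = Win-+ˡ s A∈ (¬Win-+ (opp s) (∈-game-opp s (here refl))
      (λ {B} B∈ → let (Y , Y∈ , l) = findʳ B∈ in back (B + U) (Win-+ʳ s (∈-game s (there Y∈)) l))
      (λ {X} X∈ → back (A + X) (proj₂ (All.lookup good-bs (game-opp-∈ s X∈)))))
    G+U-loses : ¬ Win s (G + U)
    G+U-loses = ¬Win-+ s (∈-game s (here refl))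
      (λ {A′} A′∈ → let (X , X∈ , l) = findˡ A′∈ in
        Win-+ʳ (opp s) (∈-game-opp s (there X∈)) (subst (λ r → ¬ Win r (A′ + X)) (sym (opp-opp s)) l))
      (λ Y∈ → proj₂ (All.lookup good-as (game-∈ s Y∈)))

-- Dead ends lie above perfect murders

murder : Res → ℕ → Game
murder s zero    = 𝟘
murder s (suc n) = game s [] (𝟘 ∷ murder s n ∷ [])

murder-L : ∀ n → murder L n ≡ M n
murder-L zero    = refl
murder-L (suc n) = cong (λ G → ⟨ [] ∣ 𝟘 ∷ G ∷ [] ⟩) (murder-L n)

murder-R : ∀ n → murder R n ≡ conj (M n)
murder-R zero    = refl
murder-R (suc n) = cong (λ G → ⟨ 𝟘 ∷ G ∷ [] ∣ [] ⟩) (murder-R n)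

ends⇒≡𝟘 : ∀ s → End s G → End (opp s) G → G ≡ 𝟘
ends⇒≡𝟘 {⟨ [] ∣ [] ⟩} L refl refl = refl
ends⇒≡𝟘 {⟨ [] ∣ [] ⟩} R refl refl = refl

-- Induction on `X`. Player `s` can only move in `X`. A move of `opp s` from `B` to `C` is imitated
-- in the murder by `𝟘` if `C` is `𝟘`, and by `murder s n` otherwise.
≥murder-suc : ∀ s n → Dead s B → ¬ End (opp s) B →
  (∀ {C} → C ∈ opts (opp s) B → ¬ End (opp s) C → C ≥[ s ] murder s n) → B ≥[ s ] murder s (suc n)
≥murder-suc {B} s n dead ¬end above = geq (game-induction _ λ X ih d → left-wins ih d , right-wins ih d)
  where
  Comparable : Game → Set
  Comparable X = DeadEnding X → (Win s (murder s (suc n) + X) → Win s (B + X)) ×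
                 (Win (opp s) (B + X) → Win (opp s) (murder s (suc n) + X))
  Hypothesis : Game → Set
  Hypothesis X = ∀ r {Y} → Y ∈ opts r X → Comparable Y
  left-wins : Hypothesis X → DeadEnding X → Win s (murder s (suc n) + X) → Win s (B + X)
  left-wins {X} ih d w with Win-+⁻ s (murder s (suc n)) X w
  ... | ends _ e    = Win-end s (B + X) (end-+ s B X (dead B here) e)
  ... | moveˡ A∈ _  = contradiction (opts-game s) (∈⇒≢[] A∈)
  ... | moveʳ Y∈ l  = Win-+ʳ s Y∈ (l ∘ proj₂ (ih s Y∈ (DeadEnding-≼ (≼-opt s Y∈) d)))
  right-wins : Hypothesis X → DeadEnding X → Win (opp s) (B + X) → Win (opp s) (murder s (suc n) + X)
  right-wins {X} ih d w with Win-+⁻ (opp s) B X w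
  ... | ends e _   = contradiction e ¬end
  ... | moveʳ {Y = Y} Y∈ l = Win-+ʳ (opp s) Y∈
    (subst (λ r → ¬ Win r (murder s (suc n) + Y)) (sym (opp-opp s))
      (subst (λ r → ¬ Win r (B + Y)) (opp-opp s) l
        ∘ proj₁ (ih (opp s) Y∈ (DeadEnding-≼ (≼-opt (opp s) Y∈) d))))
  ... | moveˡ {A = C} C∈ l with empty? (opts (opp s) C)
  ...   | inj₁ C-end = Win-+ˡ (opp s) (∈-game-opp s (here refl))
    (subst (λ C → ¬ Win (opp (opp s)) (C + X)) (ends⇒≡𝟘 s (dead C (≼-opt (opp s) C∈)) C-end) l)
  ...   | inj₂ (_ , D∈) = Win-+ˡ (opp s) (∈-game-opp s (there (here refl)))
    (subst (λ r → ¬ Win r (murder s n + X)) (sym (opp-opp s))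
      (subst (λ r → ¬ Win r (C + X)) (opp-opp s) l ∘ proj₁ (compare (above C∈ (∈⇒≢[] D∈)) X d)))

uniform-bound : {P : Game → ℕ → Set} (xs : List Game) →
  (∀ {x} → x ∈ xs → ∃[ N ] (∀ n → N ≤ n → P x n)) → ∃[ N ] (∀ {x} → x ∈ xs → ∀ n → N ≤ n → P x n)
uniform-bound []       f = 0 , λ ()
uniform-bound (x ∷ xs) f with f (here refl) | uniform-bound xs (f ∘ there)
... | N , p | N′ , q = N ⊔ N′ , λ
  { (here refl) n N≤n → p n (≤-trans (m≤m⊔n N N′) N≤n)
  ; (there x∈)  n N≤n → q x∈ n (≤-trans (m≤n⊔m N N′) N≤n) }

-- A bound beyond which every `n` works is needed, because `≥murder-suc` asks for one `n` common to
-- all options. The end `𝟘` is excluded, as it lies above no murder but `𝟘` itself.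
≥murder-eventually : ∀ s B → Dead s B → ∃[ N ] (∀ n → N ≤ n → ¬ End (opp s) B → B ≥[ s ] murder s n)
≥murder-eventually s = game-induction _ λ B ih dead →
  let (N , above) = uniform-bound (opts (opp s) B) λ C∈ → ih (opp s) C∈ (Dead-≼ s (≼-opt (opp s) C∈) dead)
  in suc N , λ { (suc n) (s≤s N≤n) ¬end → ≥murder-suc s n dead ¬end λ C∈ → above C∈ n N≤n }

Dead⇒≥murder : ∀ s B → Dead s B → ∃[ n ] B ≥[ s ] murder s n
Dead⇒≥murder s B dead with empty? (opts (opp s) B)
... | inj₂ (_ , C∈) = let (N , above) = ≥murder-eventually s B dead in N , above N ≤-refl (∈⇒≢[] C∈)
... | inj₁ B-end    = 0 , subst (_≥[ s ] 𝟘) (sym (ends⇒≡𝟘 s (dead B here) B-end)) (≥-refl s)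

-- Doubly negated because `P` need not be decidable.
least : (P : ℕ → Set) → ∀ n → P n → ¬ ¬ (∃[ m ] P m × (∀ k → k < m → ¬ P k))
least P = <-rec _ λ n ih p none → none (n , p , λ k k<n pk → ih k<n pk none)

-- Identity of game trees

-- An inductive form of `_≅_`. The second argument of `iso` is oriented from `H` to `G`, so that
-- symmetry merely exchanges the two.
data _≃_ (G H : Game) : Set where
  iso : (∀ s {A} → A ∈ opts s G → ∃[ B ] B ∈ opts s H × A ≃ B) →
        (∀ s {B} → B ∈ opts s H → ∃[ A ] A ∈ opts s G × B ≃ A) → G ≃ H

≃-opt : ∀ s → G ≃ H → A ∈ opts s G → ∃[ B ] B ∈ opts s H × A ≃ B
≃-opt s (iso f _) = f s

≃-sym : G ≃ H → H ≃ G
≃-sym (iso f g) = iso g f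

≃-trans : G ≃ H → H ≃ K → G ≃ K
≃-trans {G} = game-induction (λ G → ∀ {H K} → G ≃ H → H ≃ K → G ≃ K) step G
  where
  step : ∀ G → (∀ s {A} → A ∈ opts s G → ∀ {H K} → A ≃ H → H ≃ K → A ≃ K) → ∀ {H K} → G ≃ H → H ≃ K → G ≃ K
  step G ih (iso f g) (iso f′ g′) = iso
    (λ s A∈ → let (B , B∈ , p) = f s A∈ ; (C , C∈ , q) = f′ s B∈ in C , C∈ , ih s A∈ p q)
    (λ s C∈ → let (B , B∈ , q) = g′ s C∈ ; (A , A∈ , p) = g s B∈ in
      A , A∈ , ≃-sym (ih s A∈ (≃-sym p) (≃-sym q)))

∈ᵇ⁻ : ∀ A bs → T (∈ᵇ A bs) → ∃[ B ] B ∈ bs × A ≅ B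
∈ᵇ⁻ A (B ∷ bs) t with to (T-∨ {A ≅ᵇ B}) t
... | inj₁ p = B , here refl , p
... | inj₂ t′ = let (C , C∈ , p) = ∈ᵇ⁻ A bs t′ in C , there C∈ , p

∈ᵇ⁺ : ∀ A {bs} → B ∈ bs → A ≅ B → T (∈ᵇ A bs)
∈ᵇ⁺ {B} A (here refl) p = from (T-∨ {A ≅ᵇ B}) (inj₁ p)
∈ᵇ⁺ A {C ∷ _} (there B∈) p = from (T-∨ {A ≅ᵇ C}) (inj₂ (∈ᵇ⁺ A B∈ p))

⊆ᵇ⁻ : ∀ as bs → T (⊆ᵇ as bs) → A ∈ as → ∃[ B ] B ∈ bs × A ≅ B
⊆ᵇ⁻ (A ∷ as) bs t (here refl) = ∈ᵇ⁻ A bs (proj₁ (to (T-∧ {∈ᵇ A bs}) t))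
⊆ᵇ⁻ (A ∷ as) bs t (there A∈)  = ⊆ᵇ⁻ as bs (proj₂ (to (T-∧ {∈ᵇ A bs}) t)) A∈

⊆ᵇ⁺ : ∀ as bs → (∀ {A} → A ∈ as → ∃[ B ] B ∈ bs × A ≅ B) → T (⊆ᵇ as bs)
⊆ᵇ⁺ []       bs f = tt
⊆ᵇ⁺ (A ∷ as) bs f =
  from (T-∧ {∈ᵇ A bs}) ((let (_ , B∈ , p) = f (here refl) in ∈ᵇ⁺ A B∈ p) , ⊆ᵇ⁺ as bs (f ∘ there))

≅⁻ : ∀ G H → G ≅ H → ∀ s →
  (∀ {A} → A ∈ opts s G → ∃[ B ] B ∈ opts s H × A ≅ B) × (∀ {B} → B ∈ opts s H → ∃[ A ] A ∈ opts s G × B ≅ A)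
≅⁻ ⟨ gl ∣ gr ⟩ ⟨ hl ∣ hr ⟩ p s with to (T-∧ {⊆ᵇ gl hl ∧ ⊆ᵇ hl gl}) p
≅⁻ ⟨ gl ∣ gr ⟩ ⟨ hl ∣ hr ⟩ p L | t , _ with to (T-∧ {⊆ᵇ gl hl}) t
... | u , v = ⊆ᵇ⁻ gl hl u , ⊆ᵇ⁻ hl gl v
≅⁻ ⟨ gl ∣ gr ⟩ ⟨ hl ∣ hr ⟩ p R | _ , t with to (T-∧ {⊆ᵇ gr hr}) t
... | u , v = ⊆ᵇ⁻ gr hr u , ⊆ᵇ⁻ hr gr v

≅⁺ : ∀ G H → (∀ s {A} → A ∈ opts s G → ∃[ B ] B ∈ opts s H × A ≅ B) →
  (∀ s {B} → B ∈ opts s H → ∃[ A ] A ∈ opts s G × B ≅ A) → G ≅ H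
≅⁺ ⟨ gl ∣ gr ⟩ ⟨ hl ∣ hr ⟩ f g = from (T-∧ {⊆ᵇ gl hl ∧ ⊆ᵇ hl gl})
  ( from (T-∧ {⊆ᵇ gl hl}) (⊆ᵇ⁺ gl hl (f L) , ⊆ᵇ⁺ hl gl (g L))
  , from (T-∧ {⊆ᵇ gr hr}) (⊆ᵇ⁺ gr hr (f R) , ⊆ᵇ⁺ hr gr (g R)))

≅-sym : ∀ G H → G ≅ H → H ≅ G
≅-sym G H p = ≅⁺ H G (λ s → proj₂ (≅⁻ G H p s)) (λ s → proj₁ (≅⁻ G H p s))

≅⇒≃ : ∀ G H → G ≅ H → G ≃ H
≅⇒≃ = game-induction _ λ G ih H p → iso
  (λ s A∈ → let (B , B∈ , q) = proj₁ (≅⁻ G H p s) A∈ in B , B∈ , ih s A∈ B q)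
  (λ s {B} B∈ → let (A , A∈ , q) = proj₂ (≅⁻ G H p s) B∈ in A , A∈ , ≃-sym (ih s A∈ B (≅-sym B A q)))

≃⇒≅ : ∀ G H → G ≃ H → G ≅ H
≃⇒≅ = game-induction _ λ { G ih H (iso f g) → ≅⁺ G H
  (λ s A∈ → let (B , B∈ , q) = f s A∈ in B , B∈ , ih s A∈ B q)
  (λ s {B} B∈ → let (A , A∈ , q) = g s B∈ in A , A∈ , ≅-sym A B (ih s A∈ B (≃-sym q))) }

≃-stable : ¬ ¬ (G ≃ H) → G ≃ H
≃-stable {G} {H} ¬¬p = ≅⇒≃ G H (decidable-stable (T? (G ≅ᵇ H)) (¬¬-map (≃⇒≅ G H) ¬¬p))

-- The test `∈ᵇ` decides membership up to identity, so a witness can be recovered from classical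
-- reasoning.
member-stable : ∀ {bs} → ¬ ¬ (∃[ B ] B ∈ bs × A ≃ B) → ∃[ B ] B ∈ bs × A ≃ B
member-stable {A} {bs} ¬¬p =
  let (B , B∈ , q) = ∈ᵇ⁻ A bs (decidable-stable (T? (∈ᵇ A bs)) (¬¬-map (λ (B , B∈ , p) → ∈ᵇ⁺ A B∈ (≃⇒≅ A B p)) ¬¬p))
  in B , B∈ , ≅⇒≃ A B q

-- Invariance under identity of game trees

End-≃ : ∀ s → G ≃ H → End s G → End s H
End-≃ {G} {H} s (iso _ g) e with empty? (opts s H)
... | inj₁ e′       = e′
... | inj₂ (_ , B∈) = let (_ , A∈ , _) = g s B∈ in contradiction e (∈⇒≢[] A∈)

follower-≃ : G ≃ H → F ≼ H → ∃[ F′ ] F′ ≼ G × F′ ≃ F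
follower-≃ p here = _ , here , p
follower-≃ p (viaL B∈ F≼) =
  let (_ , A∈ , q) = ≃-opt L (≃-sym p) B∈ ; (F′ , F′≼ , r) = follower-≃ (≃-sym q) F≼ in F′ , viaL A∈ F′≼ , r
follower-≃ p (viaR B∈ F≼) =
  let (_ , A∈ , q) = ≃-opt R (≃-sym p) B∈ ; (F′ , F′≼ , r) = follower-≃ (≃-sym q) F≼ in F′ , viaR A∈ F′≼ , r

Dead-≃ : ∀ s → G ≃ H → Dead s G → Dead s H
Dead-≃ s p d F F≼ = let (F′ , F′≼ , q) = follower-≃ p F≼ in End-≃ s q (d F′ F′≼)

Dead-stable : ∀ s → ¬ ¬ Dead s G → Dead s G
Dead-stable s ¬¬d F F≼ = ≡[]-stable (opts s F) (¬¬-map (λ d → d F F≼) ¬¬d)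

Win-+-transfer : ∀ s G H X →
  (∀ {A} → A ∈ opts s G → ∃[ B ] B ∈ opts s H × (Win (opp s) (B + X) → Win (opp s) (A + X))) →
  (∀ {Y} → Y ∈ opts s X → Win (opp s) (H + Y) → Win (opp s) (G + Y)) →
  (End s G → End s H) → Win s (G + X) → Win s (H + X)
Win-+-transfer s G H X f g e w with Win-+⁻ s G X w
... | ends G-end X-end = Win-end s (H + X) (end-+ s H X (e G-end) X-end)
... | moveˡ A∈ l       = let (_ , B∈ , h) = f A∈ in Win-+ˡ s B∈ (l ∘ h)
... | moveʳ Y∈ l       = Win-+ʳ s Y∈ (l ∘ g Y∈)

-- Both directions are proved together, since a win of one player rests on a loss of the other,
-- which reverses the implication.
Win-≃ : ∀ X G H → G ≃ H → ∀ s → (Win s (G + X) → Win s (H + X)) × (Win s (H + X) → Win s (G + X))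
Win-≃ = game-induction _ λ X ihX → game-induction _ λ G ihG H p s →
  Win-+-transfer s G H X
    (λ A∈ → let (B , B∈ , q) = ≃-opt s p A∈ in B , B∈ , proj₂ (ihG s A∈ B q (opp s)))
    (λ Y∈ → proj₂ (ihX s Y∈ G H p (opp s)))
    (End-≃ s p) ,
  Win-+-transfer s H G X
    (λ B∈ → let (A , A∈ , q) = ≃-opt s (≃-sym p) B∈ in A , A∈ , proj₁ (ihG s A∈ _ (≃-sym q) (opp s)))
    (λ Y∈ → proj₁ (ihX s Y∈ G H p (opp s)))
    (End-≃ s (≃-sym p))

≃⇒≥ : ∀ s → G ≃ H → G ≥[ s ] H
≃⇒≥ s p = geq λ X _ → proj₂ (Win-≃ X _ _ p s) , proj₁ (Win-≃ X _ _ p (opp s))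

-- Local reduction, for either player

remove : Res → Game → Game → Game
remove L = removeL
remove R = removeR

opts-remove-opp : ∀ s K A → opts (opp s) (remove s K A) ≡ opts (opp s) K
opts-remove-opp L K A = refl
opts-remove-opp R K A = refl

filter-∈ : ∀ as → B ∈ filterᵇ (λ C → not (C ≅ᵇ A)) as → B ∈ as × ¬ (B ≃ A)
filter-∈ {B} {A} as B∈ with ∈-filter⁻ (λ C → T? (not (C ≅ᵇ A))) {xs = as} B∈
... | B∈′ , t = B∈′ , λ p → subst T (to T-not-≡ t) (≃⇒≅ B A p)

∈-filter : ∀ {as} → B ∈ as → ¬ (B ≃ A) → B ∈ filterᵇ (λ C → not (C ≅ᵇ A)) as
∈-filter {B} {A} B∈ ≄ = ∈-filter⁺ (λ C → T? (not (C ≅ᵇ A))) B∈ (T-not (≄ ∘ ≅⇒≃ B A))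
  where
  T-not : ∀ {b} → ¬ T b → T (not b)
  T-not {true}  ¬t = ¬t tt
  T-not {false} _  = tt

remove-∈ : ∀ s K A → B ∈ opts s (remove s K A) → B ∈ opts s K × ¬ (B ≃ A)
remove-∈ L K A = filter-∈ (left K)
remove-∈ R K A = filter-∈ (right K)

∈-remove : ∀ s K A → B ∈ opts s K → ¬ (B ≃ A) → B ∈ opts s (remove s K A)
∈-remove L K A = ∈-filter
∈-remove R K A = ∈-filter

-- Covers end-reversible and open-reversible options alike; failure of `R2` leaves only the former.
Reversible : Res → Game → Game → Set
Reversible s K A = ∃[ B ] B ∈ opts (opp s) A × K ≥[ s ] B

Fundamental : Res → Game → Game → Set
Fundamental s K A = (∀ X → DeadEnding X → End s X → Win s (K + X)) ×
  (Σ[ X ∈ Game ] DeadEnding X × End s X × ¬ Win s (remove s K A + X))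

Least : Res → Game → ℕ → Set
Least s K n = K ≥[ s ] murder s n × (∀ m → m < n → ¬ (K ≥[ s ] murder s m))

-- The fields express, in order, that `R1` to `R5` fail on the side of `s`. Identity and emptiness
-- are stable and appear without double negation.
record Reduced[_] (s : Res) (K : Game) : Set where
  field
    undominated : A ∈ opts s K → B ∈ opts s K → B ≥[ s ] A → A ≃ B
    end-reverse : A ∈ opts s K → B ∈ opts (opp s) A → K ≥[ s ] B → End s B
    fundamental : A ∈ opts s K → Reversible s K A → DeadEnding (remove s K A) → ¬ ¬ Fundamental s K A
    not-both    : A ∈ opts s K → Reversible s K A → (∀ {A′} → A′ ∈ opts s K → A′ ≃ A) →
                  C ∈ opts (opp s) K → Reversible (opp s) K C → (∀ {C′} → C′ ∈ opts (opp s) K → C′ ≃ C) → ⊥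
    canonical   : ∀ {n} → A ∈ opts s K → Reversible s K A → Least s K n → A ≃ game s [] (murder s n ∷ [])

open Reduced[_]

≤E⇒≥R : H ≥E G → G ≥[ R ] H
≤E⇒≥R = ≥-flip L ∘ ≥E⇒≥L

≥R⇒≤E : G ≥[ R ] H → H ≥E G
≥R⇒≤E = ≥L⇒≥E ∘ ≥-flip R

module _ {K : Game} (d : DeadEnding K) (irreducible : ¬ (R1 K ⊎ R2 K ⊎ R3 K ⊎ R4 K ⊎ R5 K)) where

  private
    ¬R1 : ¬ R1 K
    ¬R1 = irreducible ∘ inj₁
    ¬R2 : ¬ R2 K
    ¬R2 = irreducible ∘ inj₂ ∘ inj₁
    ¬R3 : ¬ R3 K
    ¬R3 = irreducible ∘ inj₂ ∘ inj₂ ∘ inj₁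
    ¬R4 : ¬ R4 K
    ¬R4 = irreducible ∘ inj₂ ∘ inj₂ ∘ inj₂ ∘ inj₁
    ¬R5 : ¬ R5 K
    ¬R5 = irreducible ∘ inj₂ ∘ inj₂ ∘ inj₂ ∘ inj₂

    endL : A ∈ left K → B ∈ right A → K ≥[ L ] B → LeftEnd B
    endL A∈ B∈ ge = ≡[]-stable _ λ ¬e → ¬R2 (inj₁ (_ , A∈ , _ , B∈ , ≥L⇒≥E ge , ¬e))

    endR : C ∈ right K → B ∈ left C → K ≥[ R ] B → RightEnd B
    endR C∈ B∈ ge = ≡[]-stable _ λ ¬e → ¬R2 (inj₂ (_ , C∈ , _ , B∈ , ≥R⇒≤E ge , ¬e))

    revL : A ∈ left K → Reversible L K A → EndRevL K A
    revL A∈ (B , B∈ , ge) = B , B∈ , endL A∈ B∈ ge , ≥L⇒≥E ge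

    revR : C ∈ right K → Reversible R K C → EndRevR K C
    revR C∈ (B , B∈ , ge) = B , B∈ , endR C∈ B∈ ge , ≥R⇒≤E ge

    all-≅ : ∀ {as} → (∀ {A′} → A′ ∈ as → A′ ≃ A) → All (λ A′ → A′ ≅ A) as
    all-≅ f = All.tabulate λ A∈ → ≃⇒≅ _ _ (f A∈)

  reducedL : Reduced[ L ] K
  reducedL .undominated {A} {B} A∈ B∈ ge =
    ≃-stable λ ≄ → ¬R1 (inj₁ (_ , _ , A∈ , B∈ , ≄ ∘ ≅⇒≃ A B , ≥L⇒≥E ge))
  reducedL .end-reverse = endL
  reducedL .fundamental {A} A∈ rev d′ ¬fund = ¬R3 (inj₁ (A , A∈ , revL A∈ rev ,
    (λ (w , X , dX , e , l) → ¬fund (w , X , dX , e , λ w′ → contradiction (trans (sym w′) l) λ ())) , d′))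
  reducedL .not-both {A} {C} A∈ revA A! C∈ revC C! =
    ¬R4 (A , C , A∈ , all-≅ A! , C∈ , all-≅ C! , revL A∈ revA , revR C∈ revC)
  reducedL .canonical {A} {n} A∈ rev (ge , min) rewrite murder-L n =
    ≃-stable λ ≄ → ¬R5 (inj₁ (A , A∈ , revL A∈ rev , n , ≥L⇒≥E ge ,
      (λ m m<n ge′ → min m m<n (subst (K ≥[ L ]_) (sym (murder-L m)) (≥E⇒≥L ge′))) , ≄ ∘ ≅⇒≃ A _))

  reducedR : Reduced[ R ] K
  reducedR .undominated {A} {B} A∈ B∈ ge =
    ≃-stable λ ≄ → ¬R1 (inj₂ (_ , _ , A∈ , B∈ , ≄ ∘ ≅⇒≃ A B , ≥R⇒≤E ge))
  reducedR .end-reverse = endR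
  reducedR .fundamental {A} A∈ rev d′ ¬fund = ¬R3 (inj₂ (A , A∈ , revR A∈ rev ,
    (λ (w , X , dX , e , l) → ¬fund (w , X , dX , e , λ w′ → contradiction (trans (sym w′) l) λ ())) , d′))
  reducedR .not-both {A} {C} A∈ revA A! C∈ revC C! =
    ¬R4 (C , A , C∈ , all-≅ C! , A∈ , all-≅ A! , revL C∈ revC , revR A∈ revA)
  reducedR .canonical {A} {n} A∈ rev (ge , min) rewrite murder-R n =
    ≃-stable λ ≄ → ¬R5 (inj₂ (A , A∈ , revR A∈ rev , n , ≥R⇒≤E ge ,
      (λ m m<n ge′ → min m m<n (subst (K ≥[ R ]_) (sym (murder-R m)) (≤E⇒≥R ge′))) , ≄ ∘ ≅⇒≃ A _))

LocallyReduced⇒Reduced[_] : ∀ s → LocallyReduced K → Reduced[ s ] K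
LocallyReduced⇒Reduced[ L ] (d , i) = reducedL d i
LocallyReduced⇒Reduced[ R ] (d , i) = reducedR d i

-- Matching the options of equivalent reduced games

same-or-opp : ∀ s r → r ≡ s ⊎ r ≡ opp s
same-or-opp L L = inj₁ refl
same-or-opp L R = inj₂ refl
same-or-opp R L = inj₂ refl
same-or-opp R R = inj₁ refl

_≡[E]_ : Game → Game → Set
G ≡[E] H = ∀ s → G ≥[ s ] H

≡[E]-refl : G ≡[E] G
≡[E]-refl s = ≥-refl s

≥-antisym : ∀ s → G ≥[ s ] H → H ≥[ s ] G → G ≡[E] H
≥-antisym s p q r with same-or-opp s r
... | inj₁ refl = p
... | inj₂ refl = ≥-flip s q

≡[E]-sym : G ≡[E] H → H ≡[E] G
≡[E]-sym p s = ≥-unflip s (p (opp s))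

-- The inductive step in symmetric form: `options` is the induction hypothesis for pairs of options.
record Twins (G H : Game) : Set where
  field
    reducedˡ   : LocallyReduced G
    reducedʳ   : LocallyReduced H
    equivalent : G ≡[E] H
    options    : ∀ s {A B} → A ∈ opts s G → B ∈ opts s H → A ≡[E] B → A ≃ B

open Twins

Twins-sym : Twins G H → Twins H G
Twins-sym t .reducedˡ   = t .reducedʳ
Twins-sym t .reducedʳ   = t .reducedˡ
Twins-sym t .equivalent = ≡[E]-sym (t .equivalent)
Twins-sym t .options s B∈ A∈ e = ≃-sym (t .options s A∈ B∈ (≡[E]-sym e))

Reversible-≃ : ∀ s → A ≃ B → Reversible s K A → Reversible s K B
Reversible-≃ s p (C , C∈ , ge) =
  let (D , D∈ , q) = ≃-opt (opp s) p C∈ in D , D∈ , ≥-trans s ge (≃⇒≥ s q)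

-- The game through which `A` reverses is a dead `s`-end below `K`, and some murder lies below it in
-- turn.
least-murder : ∀ s → LocallyReduced K → A ∈ opts s K → Reversible s K A → ¬ ¬ (∃[ n ] Least s K n)
least-murder {K} s red@(d , _) A∈ (B , B∈ , ge) =
  let B-end   = end-reverse (LocallyReduced⇒Reduced[ s ] red) A∈ B∈ ge
      B≼      = via s A∈ (≼-opt (opp s) B∈)
      (n , q) = Dead⇒≥murder s B (DeadEnding⇒Dead s d B≼ B-end)
  in least (λ n → K ≥[ s ] murder s n) n (≥-trans s ge q)

Least-≡ : ∀ s {n} → G ≡[E] H → Least s G n → Least s H n
Least-≡ s e (ge , min) = ≥-trans s (≡[E]-sym e s) ge , λ m m<n → min m m<n ∘ ≥-trans s (e s)

-- Both options are the canonical one for the least `n`, which equivalent games share. With `G` as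
-- `H`, all reversible `s`-options of one game are identical.
reversible-≃ : ∀ s → LocallyReduced G → LocallyReduced H → G ≡[E] H →
  A ∈ opts s G → Reversible s G A → B ∈ opts s H → Reversible s H B → A ≃ B
reversible-≃ s redG redH e A∈ revA B∈ revB = ≃-stable do
  (n , ln) ← least-murder s redG A∈ revA
  pure (≃-trans (canonical (LocallyReduced⇒Reduced[ s ] redG) A∈ revA ln)
    (≃-sym (canonical (LocallyReduced⇒Reduced[ s ] redH) B∈ revB (Least-≡ s e ln))))

-- Maintenance applied twice gives `B` above `A` and `A′` above `B`. As `G` has no dominated
-- options, `A′` is `A`, so `A` and `B` are equivalent and the induction hypothesis applies.
irreversible-match : ∀ s → Twins G H → A ∈ opts s G → ¬ Reversible s G A →
  ¬ ¬ (∃[ B ] B ∈ opts s H × A ≃ B × ¬ Reversible s H B)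
irreversible-match {G} {H} {A} s t A∈ irr = do
  inj₁ (B , B∈ , B≥A) ← maintenance s H≥G A∈
    where inj₂ (C , C∈ , H≥C) → contradiction (C , C∈ , ≥-trans s G≥H H≥C) irr
  let irrB = irreversible B∈ B≥A
  inj₁ (A′ , A′∈ , A′≥B) ← maintenance s G≥H B∈
    where inj₂ (C , C∈ , G≥C) → contradiction (C , C∈ , ≥-trans s H≥G G≥C) irrB
  let A≃A′ = undominated (LocallyReduced⇒Reduced[ s ] (t .reducedˡ)) A∈ A′∈ (≥-trans s A′≥B B≥A)
  pure (B , B∈ , t .options s A∈ B∈ (≥-antisym s (≥-trans s (≃⇒≥ s A≃A′) A′≥B) B≥A) , irrB)
  where
  G≥H : G ≥[ s ] H
  G≥H = t .equivalent s
  H≥G : H ≥[ s ] G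
  H≥G = ≡[E]-sym (t .equivalent) s
  -- If `B` reversed through `C`, maintenance would yield either an option of `A` below `C`,
  -- reversing `A` in `G`, or an `s`-option of `C`, which is an `s`-end.
  irreversible : B ∈ opts s H → B ≥[ s ] A → ¬ Reversible s H B
  irreversible {B} B∈ B≥A (C , C∈ , H≥C) = maintenance (opp s) (≥-flip s B≥A) C∈ λ
    { (inj₁ (D , D∈ , D≥C)) → irr (D , D∈ , ≥-trans s G≥H (≥-trans s H≥C (≥-unflip s D≥C)))
    ; (inj₂ (D , D∈ , _)) →
        ∈⇒≢[] (subst (λ r → D ∈ opts r C) (opp-opp s) D∈)
          (end-reverse (LocallyReduced⇒Reduced[ s ] (t .reducedʳ)) B∈ C∈ H≥C) }

-- Removal can only create a new `s`-end at the root, and only then must the `opp s`-options be dead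
-- `s`-ends. Everything else is inherited from `G`.
DeadEnding-remove : ∀ s A → DeadEnding G → (End s (remove s G A) → ∀ {C} → C ∈ opts (opp s) G → Dead s C) →
  DeadEnding (remove s G A)
DeadEnding-remove {G} s A d dead = DeadEnding-opts s
  (λ B∈ → DeadEnding-≼ (≼-opt s (s-option B∈)) d)
  (λ C∈ → DeadEnding-≼ (≼-opt (opp s) (opp-option C∈)) d)
  ends-dead
  where
  s-option : B ∈ opts s (remove s G A) → B ∈ opts s G
  s-option = proj₁ ∘ remove-∈ s G A
  opp-option : C ∈ opts (opp s) (remove s G A) → C ∈ opts (opp s) G
  opp-option = subst (_ ∈_) (opts-remove-opp s G A)
  ends-dead : ∀ r → End r (remove s G A) → Dead r (remove s G A)
  ends-dead r e with same-or-opp s r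
  ... | inj₁ refl = Dead-game s e (dead e ∘ opp-option)
  ... | inj₂ refl = Dead-game (opp s) e λ {B} B∈ → Dead-≼ (opp s)
    (≼-opt s (s-option (subst (λ r → B ∈ opts r (remove s G A)) (opp-opp s) B∈)))
    (DeadEnding⇒Dead (opp s) d here (trans (sym (opts-remove-opp s G A)) e))

-- Without A, G has the same s-options as H, so that A cannot be fundamental in G.  By reducedness,
-- removing A must then leave the class of dead-ending games.
reversible-sole : ∀ s → Twins G H → A ∈ opts s G → Reversible s G A →
  (∀ {B} → B ∈ opts s H → ¬ Reversible s H B) →
  End s H × (∀ {A′} → A′ ∈ opts s G → A′ ≃ A) × ¬ DeadEnding (remove s G A)
reversible-sole {G} {H} {A} s t A∈ rev irr =
  End-H , sole , ¬DeadEnding-G∖A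
  where
  G∖A : Game
  G∖A = remove s G A
  d : DeadEnding G
  d = proj₁ (t .reducedˡ)
  red : Reduced[ s ] G
  red = LocallyReduced⇒Reduced[ s ] (t .reducedˡ)
  H⊆G∖A : B ∈ opts s H → ∃[ A′ ] A′ ∈ opts s G∖A × B ≃ A′
  H⊆G∖A B∈ = member-stable do
    (A′ , A′∈ , p , irrA′) ← irreversible-match s (Twins-sym t) B∈ (irr B∈)
    -- Being irreversible, `A′` differs from `A` and survives the removal.
    pure (A′ , ∈-remove s G A A′∈ (λ q → irrA′ (Reversible-≃ s (≃-sym q) rev)) , p)
  G∖A⊆H : ∀ {A′} → A′ ∈ opts s G∖A → ∃[ B ] B ∈ opts s H × A′ ≃ B
  G∖A⊆H A′∈G∖A = let (A′∈ , A′≄A) = remove-∈ s G A A′∈G∖A in member-stable do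
    (B , B∈ , p , _) ← irreversible-match s t A′∈ λ rev′ →
      A′≄A (reversible-≃ s (t .reducedˡ) (t .reducedˡ) ≡[E]-refl A′∈ rev′ A∈ rev)
    pure (B , B∈ , p)
  End-G∖A⇒End-H : End s G∖A → End s H
  End-G∖A⇒End-H e with empty? (opts s H)
  ... | inj₁ e′       = e′
  ... | inj₂ (_ , B∈) = contradiction e (∈⇒≢[] (proj₁ (proj₂ (H⊆G∖A B∈))))
  End-H⇒End-G∖A : End s H → End s G∖A
  End-H⇒End-G∖A e with empty? (opts s G∖A)
  ... | inj₁ e′       = e′
  ... | inj₂ (_ , A∈) = contradiction e (∈⇒≢[] (proj₁ (proj₂ (G∖A⊆H A∈))))
  -- As `X` has no `s`-option, `s` must move in the first component, and matching `s`-options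
  -- suffice.
  Win-H⇒Win-G∖A : End s X → Win s (H + X) → Win s (G∖A + X)
  Win-H⇒Win-G∖A {X} X-end = Win-+-transfer s H G∖A X
    (λ B∈ → let (A′ , A′∈ , p) = H⊆G∖A B∈ in A′ , A′∈ , proj₂ (Win-≃ X _ A′ p (opp s)))
    (λ Y∈ → contradiction X-end (∈⇒≢[] Y∈))
    End-H⇒End-G∖A
  ¬DeadEnding-G∖A : ¬ DeadEnding G∖A
  ¬DeadEnding-G∖A d′ = fundamental red A∈ rev d′ λ (G-wins , X , dX , X-end , G∖A-loses) →
    G∖A-loses (Win-H⇒Win-G∖A X-end (proj₁ (compare (≡[E]-sym (t .equivalent) s) X dX) (G-wins X dX X-end)))
  -- A remaining `s`-option would make the removal dead-ending.
  End-G∖A : End s G∖A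
  End-G∖A = ≡[]-stable (opts s G∖A) λ ¬e → ¬DeadEnding-G∖A (DeadEnding-remove s A d λ e → contradiction e ¬e)
  End-H : End s H
  End-H = End-G∖A⇒End-H End-G∖A
  sole : ∀ {A′} → A′ ∈ opts s G → A′ ≃ A
  sole A′∈ = ≃-stable λ ≄ → ∈⇒≢[] (∈-remove s G A A′∈ ≄) End-G∖A

-- If H had no reversible s-option, it would be a dead s-end and A the sole s-option of G, with
-- G ∖ A outside the class.  The (opp s)-options of G matched in H are dead s-ends, and if all
-- were, G ∖ A would be dead-ending.  So G has a reversible (opp s)-option C; but a dead s-end H
-- has no reversible (opp s)-option, hence C is sole as well and G = {A | C} is reducible.
reversible-counterpart : ∀ s → Twins G H → A ∈ opts s G → Reversible s G A →
  ¬ ¬ (∃[ B ] B ∈ opts s H × Reversible s H B)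
reversible-counterpart {G} {H} {A} s t A∈ rev none =
  ¬DeadEnding-removal (DeadEnding-remove s A (proj₁ (t .reducedˡ)) λ _ C∈ → Dead-stable s do
    (D , D∈ , p , _) ← irreversible-match (opp s) t C∈ (irreversible C∈)
    pure (Dead-≃ s (≃-sym p) (option-dead D∈)))
  where
  lone : End s H × (∀ {A′} → A′ ∈ opts s G → A′ ≃ A) × ¬ DeadEnding (remove s G A)
  lone = reversible-sole s t A∈ rev λ B∈ revB → none (_ , B∈ , revB)
  ¬DeadEnding-removal : ¬ DeadEnding (remove s G A)
  ¬DeadEnding-removal = proj₂ (proj₂ lone)
  option-dead : C ∈ opts (opp s) H → Dead s C
  option-dead C∈ = Dead-≼ s (≼-opt (opp s) C∈) (DeadEnding⇒Dead s (proj₁ (t .reducedʳ)) here (proj₁ lone))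
  irreversible : C ∈ opts (opp s) G → ¬ Reversible (opp s) G C
  irreversible {C} C∈ revC = not-both (LocallyReduced⇒Reduced[ s ] (t .reducedˡ)) A∈ rev (proj₁ (proj₂ lone)) C∈ revC
    (proj₁ (proj₂ (reversible-sole (opp s) t C∈ revC λ {B} B∈ (D , D∈ , _) →
      ∈⇒≢[] (subst (λ r → D ∈ opts r B) (opp-opp s) D∈) (option-dead B∈ B here))))

-- The case split on reversibility is classical; `member-stable` then extracts the matching option.
counterpart : ∀ s → Twins G H → A ∈ opts s G → ∃[ B ] B ∈ opts s H × A ≃ B
counterpart {G} {H} {A} s t A∈ = member-stable do
  yes rev ← ¬¬-excluded-middle {A = Reversible s G A}
    where no irr → ¬¬-map (λ (B , B∈ , p , _) → B , B∈ , p) (irreversible-match s t A∈ irr)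
  (B , B∈ , revB) ← reversible-counterpart s t A∈ rev
  pure (B , B∈ , reversible-≃ s (t .reducedˡ) (t .reducedʳ) (t .equivalent) A∈ rev B∈ revB)

Twins⇒≃ : Twins G H → G ≃ H
Twins⇒≃ t = iso (λ s → counterpart s t) (λ s → counterpart s (Twins-sym t))

Reduced-≼ : F ≼ G → Reduced G → Reduced F
Reduced-≼ F≼ (d , r) = DeadEnding-≼ F≼ d , λ F′ F′≼ → r F′ (≼-trans F′≼ F≼)

reduced-unique : ∀ G H → Reduced G → Reduced H → G ≡[E] H → G ≃ H
reduced-unique = game-induction _ λ G ih H redG redH e → Twins⇒≃ record
  { reducedˡ   = proj₂ redG G here
  ; reducedʳ   = proj₂ redH H here
  ; equivalent = e
  ; options    = λ s {A} {B} A∈ B∈ → ih s A∈ B (Reduced-≼ (≼-opt s A∈) redG) (Reduced-≼ (≼-opt s B∈) redH)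
  }

mainTheorem11 : (G H : Game) → DeadEnding G → DeadEnding H →
    Reduced G → Reduced H → G ≡E H → G ≅ H
mainTheorem11 G H _ _ redG redH (G≥H , H≥G) =
  ≃⇒≅ G H (reduced-unique G H redG redH (≥-antisym L (≥E⇒≥L G≥H) (≥E⇒≥L H≥G)))
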